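{- Let $L=\{F\}$ be the first-order language with one unary function symbol $F$. The property $\phi(x):=(F(x)\neq x)$ is regular.
   Context: $\mathbf{S}_n(L)$ is the set of $L$-structures $\mathcal{M}=\langle M,f\rangle$ with $M=\{1,\ldots,n\}$ and $f:M\to M$. For a first-order formula $\phi(x)$ of $L$ with one free variable and without parameters, $\phi(\mathcal{M})=\{a\in M:\mathcal{M}\models\phi(a)\}$. Let $\mathbf{S}_{2n}(\phi:\mathrm{ntr})=\{\mathcal{M}\in\mathbf{S}_{2n}(L):|\phi(\mathcal{M})|=n\}$, $d_{2n}(\phi:\mathrm{ntr})=|\mathbf{S}_{2n}(\phi:\mathrm{ntr})|/|\mathbf{S}_{2n}(L)|$, and $d(\phi:\mathrm{ntr})=\lim_{n\to\infty}d_{2n}(\phi:\mathrm{ntr})$ whenever this limit exists. The property $\phi(x)$ is regular if $d(\phi:\mathrm{ntr})=0$. -}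

module Defs where

open import Data.Empty using (⊥)
open import Data.Fin.Base using (Fin; zero; suc; finToFun; funToFin; combine)
open import Data.Fin.Properties as Fin
  using (all?; any?; finToFun-funToFin; funToFin-finToFin)
open import Data.Fin.Subset using (Subset; ∣_∣)
open import Data.Integer.Base using (+_)
open import Data.List.Base using (List; tabulate; filter; length)
open import Data.List.Properties using (length-tabulate)
open import Data.List.Relation.Unary.Any using (Any)
import Data.List.Relation.Unary.Any.Properties as Any
open import Data.List.Relation.Unary.AllPairs using (AllPairs)
import Data.List.Relation.Unary.AllPairs.Properties as AllPairs
open import Data.Nat.Base as ℕ using (ℕ; zero; suc; NonZero)
import Data.Nat.Properties as ℕ
open import Data.Product.Base using (_×_; _,_; ∃-syntax)
open import Data.Rational.Base as ℚ using (ℚ; 0ℚ)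
open import Data.Sum.Base using (_⊎_)
import Data.Vec.Base as Vec
open import Data.Vec.Functional using (Vector; _∷_; [])
open import Relation.Binary.PropositionalEquality
  using (_≡_; _≗_; refl; sym; trans; cong₂; subst)
open import Relation.Nullary using (Dec; yes; no; does; ¬_)
open import Relation.Nullary.Decidable using (¬?; _×-dec_; _⊎-dec_; _→-dec_)

-- First-order logic with equality over L = {F}, F unary.  Variables are
-- de Bruijn indices: a Formula k has its free variables among k ones, and
-- a quantifier binds variable zero of its body.

infix  8 _≐_
infixr 7 _⟨∧⟩_
infixr 6 _⟨∨⟩_
infixr 5 _⟨⇒⟩_

data Term (k : ℕ) : Set where
  var : Fin k → Term k
  F   : Term k → Term k

data Formula (k : ℕ) : Set where
  _≐_               : Term k → Term k → Formula k
  ⟨⊥⟩               : Formula k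
  ⟨¬⟩_              : Formula k → Formula k
  _⟨∧⟩_ _⟨∨⟩_ _⟨⇒⟩_ : Formula k → Formula k → Formula k
  ⟨∀⟩_ ⟨∃⟩_         : Formula (suc k) → Formula k

-- The structure ⟨M , f⟩ with M = {1, …, n} (here Fin n), given by its f.
Structure : ℕ → Set
Structure n = Fin n → Fin n

⟦_⟧ : ∀ {k n} → Term k → Structure n → Vector (Fin n) k → Fin n
⟦ var i ⟧ f ρ = ρ i
⟦ F t   ⟧ f ρ = f (⟦ t ⟧ f ρ)

infix 4 _,_⊨_ _,_⊨?_

-- Satisfaction is decidable (see _,_⊨?_), so the constructive reading of the
-- connectives and quantifiers below agrees with the classical one.
_,_⊨_ : ∀ {k n} → Structure n → Vector (Fin n) k → Formula k → Set
f , ρ ⊨ s ≐ t     = ⟦ s ⟧ f ρ ≡ ⟦ t ⟧ f ρ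
f , ρ ⊨ ⟨⊥⟩       = ⊥
f , ρ ⊨ ⟨¬⟩ φ     = ¬ (f , ρ ⊨ φ)
f , ρ ⊨ φ ⟨∧⟩ ψ   = (f , ρ ⊨ φ) × (f , ρ ⊨ ψ)
f , ρ ⊨ φ ⟨∨⟩ ψ   = (f , ρ ⊨ φ) ⊎ (f , ρ ⊨ ψ)
f , ρ ⊨ φ ⟨⇒⟩ ψ   = (f , ρ ⊨ φ) → (f , ρ ⊨ ψ)
f , ρ ⊨ ⟨∀⟩ φ     = ∀ a → f , (a ∷ ρ) ⊨ φ
f , ρ ⊨ ⟨∃⟩ φ     = ∃[ a ] (f , (a ∷ ρ) ⊨ φ)

_,_⊨?_ : ∀ {k n} (f : Structure n) (ρ : Vector (Fin n) k) (φ : Formula k) →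
         Dec (f , ρ ⊨ φ)
f , ρ ⊨? s ≐ t     = ⟦ s ⟧ f ρ Fin.≟ ⟦ t ⟧ f ρ
f , ρ ⊨? ⟨⊥⟩       = no λ ()
f , ρ ⊨? ⟨¬⟩ φ     = ¬? (f , ρ ⊨? φ)
f , ρ ⊨? φ ⟨∧⟩ ψ   = (f , ρ ⊨? φ) ×-dec (f , ρ ⊨? ψ)
f , ρ ⊨? φ ⟨∨⟩ ψ   = (f , ρ ⊨? φ) ⊎-dec (f , ρ ⊨? ψ)
f , ρ ⊨? φ ⟨⇒⟩ ψ   = (f , ρ ⊨? φ) →-dec (f , ρ ⊨? ψ)
f , ρ ⊨? ⟨∀⟩ φ     = all? λ a → f , (a ∷ ρ) ⊨? φ
f , ρ ⊨? ⟨∃⟩ φ     = any? λ a → f , (a ∷ ρ) ⊨? φ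

definedSet : ∀ {n} → Formula 1 → Structure n → Subset n
definedSet φ f = Vec.tabulate λ a → does (f , (a ∷ []) ⊨? φ)

-- 𝐒 n lists every structure on Fin n exactly once, up to pointwise equality
-- (𝐒-complete, 𝐒-distinct), so lengths of filtered lists are cardinalities.
𝐒 : ∀ n → List (Structure n)
𝐒 n = tabulate {n = n ℕ.^ n} finToFun

𝐒-complete : ∀ n (f : Structure n) → Any (_≗ f) (𝐒 n)
𝐒-complete n f = Any.tabulate⁺ (funToFin f) (finToFun-funToFin f)

funToFin-cong : ∀ {m n} {f g : Fin m → Fin n} → f ≗ g → funToFin f ≡ funToFin g
funToFin-cong {zero}  f≗g = refl
funToFin-cong {suc m} f≗g =
  cong₂ combine (f≗g zero) (funToFin-cong λ i → f≗g (suc i))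

𝐒-distinct : ∀ n → AllPairs (λ f g → ¬ (f ≗ g)) (𝐒 n)
𝐒-distinct n = AllPairs.tabulate⁺ λ {i} {j} i≢j f≗g → i≢j
  (trans (sym (funToFin-finToFin {n} {n} i))
         (trans (funToFin-cong f≗g) (funToFin-finToFin {n} {n} j)))

𝐒-nonZero : ∀ n → NonZero (length (𝐒 n))
𝐒-nonZero n = subst NonZero (sym (length-tabulate {n = n ℕ.^ n} finToFun)) (n^n≢0 n)
  where
  n^n≢0 : ∀ n → NonZero (n ℕ.^ n)
  n^n≢0 zero    = _
  n^n≢0 (suc n) = ℕ.m^n≢0 (suc n) (suc n)

𝐒-ntr : Formula 1 → ∀ n → List (Structure (2 ℕ.* n))
𝐒-ntr φ n = filter (λ f → ∣ definedSet φ f ∣ ℕ.≟ n) (𝐒 (2 ℕ.* n))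

-- d-ntr φ n is d₂ₙ(φ : ntr).
d-ntr : Formula 1 → ℕ → ℚ
d-ntr φ n = (+ length (𝐒-ntr φ n) ℚ./ length (𝐒 (2 ℕ.* n))) {{𝐒-nonZero (2 ℕ.* n)}}

-- For rational sequences with a rational limit, testing against rational ε
-- is equivalent to testing against real ε.
ConvergesTo : (ℕ → ℚ) → ℚ → Set
ConvergesTo a l =
  ∀ ε → 0ℚ ℚ.< ε → ∃[ N ] (∀ n → N ℕ.≤ n → ℚ.∣ a n ℚ.- l ∣ ℚ.< ε)

Regular : Formula 1 → Set
Regular φ = ConvergesTo (d-ntr φ) 0ℚ

{-# OPTIONS --safe #-}

-- A uniformly random self-map of an N-element set fixes each point with
-- probability 1/N, so it has exactly one fixed point on average.  By Markov's
-- inequality at most a proportion 1/n of the structures on 2n points have as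
-- many as n fixed points, hence d₂ₙ ≤ 1/n.

module Submission where

open import Defs
open import Data.Bool.Base using (true; false; if_then_else_)
open import Data.Fin.Base
  using (Fin; zero; suc; _↑ˡ_; _↑ʳ_; combine; remQuot; finToFun)
open import Data.Fin.Properties as Fin using (remQuot-combine)
open import Data.Fin.Subset using (∣_∣)
import Data.Integer.Base as ℤ
import Data.Integer.Properties as ℤ
open import Data.List.Base using (length; filter; tabulate)
open import Data.List.Properties using (length-tabulate)
open import Data.Nat.Base
open import Data.Nat.Properties
open import Data.Nat.Tactic.RingSolver using (solve-∀)
open import Data.Product.Base using (_×_; _,_)
open import Data.Rational.Base as ℚ using (0ℚ)
import Data.Rational.Properties as ℚ
import Data.Rational.Unnormalised.Base as ℚᵘ
import Data.Rational.Unnormalised.Properties as ℚᵘ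
import Data.Vec.Base as Vec
open import Function.Base using (_∘_)
open import Level using (Level)
open import Relation.Binary.PropositionalEquality
open import Relation.Nullary using (Dec; yes; no; does)
open import Relation.Nullary.Decidable using (¬?)
open import Relation.Unary using (Pred; Decidable)

open import Algebra.Properties.Semiring.Sum +-*-semiring

private variable
  a p : Level
  A : Set a
  P : Set p

-- The Iverson bracket. Branching on `does` alone lets it reduce when `suc a` is compared with
-- `suc b`.
⟦_⟧ᵢ : Dec P → ℕ
⟦ P? ⟧ᵢ = if does P? then 1 else 0

∑-const : ∀ n c → ∑[ i < n ] c ≡ n * c
∑-const zero    c = refl
∑-const (suc n) c = cong (c +_) (∑-const n c)

∑-↑ : ∀ m {n} (t : Fin (m + n) → ℕ) →
      sum t ≡ ∑[ i < m ] t (i ↑ˡ n) + ∑[ j < n ] t (m ↑ʳ j)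
∑-↑ zero    t = refl
∑-↑ (suc m) t = trans (cong (t zero +_) (∑-↑ m (t ∘ suc)))
                      (sym (+-assoc (t zero) _ _))

∑-combine : ∀ m n (t : Fin (m * n) → ℕ) →
            sum t ≡ ∑[ i < m ] ∑[ j < n ] t (combine i j)
∑-combine zero    n t = refl
∑-combine (suc m) n t = trans (∑-↑ n t)
  (cong (∑[ j < n ] t (j ↑ˡ (m * n)) +_) (∑-combine m n (t ∘ (n ↑ʳ_))))

∑-remQuot : ∀ m n (t : Fin m × Fin n → ℕ) →
            ∑[ k < m * n ] t (remQuot n k) ≡ ∑[ i < m ] ∑[ j < n ] t (i , j)
∑-remQuot m n t = trans (∑-combine m n (t ∘ remQuot n))
  (sum-cong-≗ λ i → sum-cong-≗ λ j → cong t (remQuot-combine i j))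

∑-⟦≟⟧ : ∀ {n} (b : Fin n) → ∑[ a < n ] ⟦ a Fin.≟ b ⟧ᵢ ≡ 1
∑-⟦≟⟧ {suc n} zero    = cong suc (sum-replicate-zero n)
∑-⟦≟⟧ {suc n} (suc b) = ∑-⟦≟⟧ b

-- Fixed points are agreements with the identity, but induction on the domain needs arbitrary `g`
-- and separate `m`, `n`: dropping the argument `zero` turns the identity into `suc`.
agreements : ∀ {m n} → (Fin m → Fin n) → (Fin m → Fin n) → ℕ
agreements {m} f g = ∑[ i < m ] ⟦ f i Fin.≟ g i ⟧ᵢ

-- Multiplied by n to avoid the exponent m ∸ 1.
∑-agreements : ∀ {m n} (g : Fin m → Fin n) →
               n * ∑[ k < n ^ m ] agreements (finToFun k) g ≡ m * n ^ m
∑-agreements {zero}  {n} g = *-zeroʳ n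
∑-agreements {suc m} {n} g = begin
  n * ∑[ k < n * N ] agreements (finToFun {n} {suc m} k) g
    -- By definition of `finToFun`, the quotient of a code is the value at `zero` and the remainder
    -- codes the restriction to the successors.
    ≡⟨ cong (n *_) (∑-remQuot n N (λ (q , r) → hit q + agr r)) ⟩
  n * ∑[ q < n ] ∑[ r < N ] (hit q + agr r)
    ≡⟨ cong (n *_) (sum-cong-≗ λ q →
         trans (∑-distrib-+ {N} (λ _ → hit q) agr)
               (cong (_+ sum agr) (∑-const N (hit q)))) ⟩
  n * ∑[ q < n ] (N * hit q + sum agr)
    ≡⟨ cong (n *_) (∑-distrib-+ {n} (λ q → N * hit q) (λ _ → sum agr)) ⟩
  n * (∑[ q < n ] (N * hit q) + ∑[ q < n ] sum agr)
    ≡⟨ cong (n *_) (cong₂ _+_ (sym (*-distribˡ-sum N hit)) (∑-const n (sum agr))) ⟩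
  n * (N * sum hit + n * sum agr)
    ≡⟨ cong (n *_) (cong₂ _+_ (cong (N *_) (∑-⟦≟⟧ (g zero))) (∑-agreements (g ∘ suc))) ⟩
  n * (N * 1 + m * N)
    ≡⟨ regroup n N m ⟩
  suc m * (n * N) ∎
  where
  open ≡-Reasoning
  N = n ^ m
  hit : Fin n → ℕ
  hit q = ⟦ q Fin.≟ g zero ⟧ᵢ
  agr : Fin N → ℕ
  agr r = agreements (finToFun r) (g ∘ suc)
  regroup : ∀ x y z → x * (y * 1 + z * y) ≡ suc z * (x * y)
  regroup = solve-∀

fixedPoints : ∀ {n} → Structure n → ℕ
fixedPoints f = agreements f (λ a → a)

-- Equality fails only at `0`, where the single empty map has no fixed point.
∑-fixedPoints : ∀ n → ∑[ k < n ^ n ] fixedPoints (finToFun {n} {n} k) ≤ n ^ n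
∑-fixedPoints zero    = z≤n
∑-fixedPoints (suc n) = ≤-reflexive
  (*-cancelˡ-≡ _ (suc n ^ suc n) (suc n) (∑-agreements {suc n} {suc n} (λ a → a)))

-- Each index is counted once, in the subset or in the sum, according to the Boolean `does (Q? i)`.
∣tabulate-¬?∣ : ∀ {n} {Q : Pred (Fin n) p} (Q? : Decidable Q) →
  ∣ Vec.tabulate (λ i → does (¬? (Q? i))) ∣ + ∑[ i < n ] ⟦ Q? i ⟧ᵢ ≡ n
∣tabulate-¬?∣ {n = zero}  Q? = refl
∣tabulate-¬?∣ {n = suc n} Q? with does (Q? zero)
... | true  = trans (+-suc _ _) (cong suc (∣tabulate-¬?∣ (Q? ∘ suc)))
... | false = cong suc (∣tabulate-¬?∣ (Q? ∘ suc))

-- Markov's inequality without division: an entry satisfying `Q` adds `c` on the left and at least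
-- `c` on the right, any other entry adds nothing on the left.
markov : ∀ {Q : Pred A p} (Q? : Decidable Q) (w : A → ℕ) c →
         (∀ {x} → Q x → c ≤ w x) → ∀ {n} (xs : Fin n → A) →
         length (filter Q? (tabulate xs)) * c ≤ ∑[ i < n ] w (xs i)
markov Q? w c c≤w {zero}  xs = z≤n
markov Q? w c c≤w {suc n} xs with Q? (xs zero)
... | yes q = +-mono-≤ (c≤w q) (markov Q? w c c≤w (xs ∘ suc))
... | no _  = m≤n⇒m≤o+n (w (xs zero)) (markov Q? w c c≤w (xs ∘ suc))

nonFixed : Formula 1
nonFixed = ⟨¬⟩ (F (var zero) ≐ var zero)

length-𝐒-ntr : ∀ n → length (𝐒-ntr nonFixed n) * n ≤ length (𝐒 (2 * n))
length-𝐒-ntr n = begin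
  length (𝐒-ntr nonFixed n) * n
    ≤⟨ markov (λ f → ∣ definedSet nonFixed f ∣ ≟ n) fixedPoints n
         (λ {f} → n≤fixedPoints f) (finToFun {2 * n} {2 * n}) ⟩
  ∑[ k < (2 * n) ^ (2 * n) ] fixedPoints (finToFun {2 * n} {2 * n} k)
    ≤⟨ ∑-fixedPoints (2 * n) ⟩
  (2 * n) ^ (2 * n)
    ≡⟨ length-tabulate (finToFun {2 * n} {2 * n}) ⟨
  length (𝐒 (2 * n)) ∎
  where
  open ≤-Reasoning
  n≤fixedPoints : ∀ f → ∣ definedSet nonFixed f ∣ ≡ n → n ≤ fixedPoints f
  n≤fixedPoints f eq = ≤-reflexive (sym (trans
    -- `2 * n` unfolds to `n + (n + 0)`; cancelling the `n` moved points leaves `n + 0` fixed ones.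
    (+-cancelˡ-≡ n _ _ (trans (cong (_+ fixedPoints f) (sym eq))
                              (∣tabulate-¬?∣ λ a → f a Fin.≟ a)))
    (+-identityʳ n)))

0≤+/ : ∀ c d .{{_ : NonZero d}} → 0ℚ ℚ.≤ ℤ.+ c ℚ./ d
0≤+/ c d = ℚ.nonNegative⁻¹ _ {{ℚ.normalize-nonNeg c d}}

-- A positive `ε` is at least the reciprocal of its denominator, hence above `1/n`, while
-- `c * n ≤ d` puts `c/d` at or below `1/n`.
+/-< : ∀ {ε} → 0ℚ ℚ.< ε → ∀ c d {n} .{{_ : NonZero d}} →
       c * n ≤ d → ℚ.↧ₙ ε < n → ℤ.+ c ℚ./ d ℚ.< ε
+/-< {ℚ.mkℚ (ℤ.+ zero) _ _} (ℚ.*<* (ℤ.+<+ ()))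
+/-< {ε@(ℚ.mkℚ ℤ.+[1+ p ] q-1 _)} _ c d@(suc d-1) {n} cn≤d q<n =
  ℚ.toℚᵘ-cancel-< (ℚᵘ.<-respˡ-≃ (ℚᵘ.≃-sym (ℚ.toℚᵘ-fromℚᵘ (ℚᵘ.mkℚᵘ (ℤ.+ c) d-1)))
    (ℚᵘ.*<* (subst (ℤ._< ℤ.+[1+ p ] ℤ.* ℤ.+ d) (ℤ.pos-* c (suc q-1))
      (ℤ.+<+ (<-≤-trans (cq<d c cn≤d) (m≤n*m d (suc p)))))))
  where
  cq<d : ∀ c → c * n ≤ d → c * suc q-1 < d
  -- Multiplying `q<n` by `c` stays strict only for positive `c`; for `c = 0` the positivity of `d`
  -- gives strictness.
  cq<d zero      _    = z<s
  cq<d c@(suc _) cn≤d = <-≤-trans (*-monoʳ-< c q<n) cn≤d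

proposition5p2 : Regular (⟨¬⟩ (F (var zero) ≐ var zero))
-- The successor makes `N ≤ n` the strict bound `ℚ.↧ₙ ε < n`, so that `1/n < ε`.
proposition5p2 ε 0<ε = suc (ℚ.↧ₙ ε) , λ n q<n →
  let c = length (𝐒-ntr nonFixed n)
      d = length (𝐒 (2 * n))
      instance _ = 𝐒-nonZero (2 * n)
  in subst (ℚ._< ε)
       (sym (trans (cong ℚ.∣_∣ (ℚ.+-identityʳ (d-ntr nonFixed n)))
                   (ℚ.0≤p⇒∣p∣≡p (0≤+/ c d))))
       (+/-< 0<ε c d (length-𝐒-ntr n) q<n)
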